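{- There is a computably discrete, computably Hausdorff, precomputably Quasi-Polish space $\mathbf{X}$ such that there is no computable injection $\iota:\mathbf{X}\to\mathbb{N}$.
   Context: A represented space $\mathbf{X}=(X,\delta_{\mathbf{X}})$ is a set $X$ with a partial surjection $\delta_{\mathbf{X}}:\subseteq\mathbb{N}^{\mathbb{N}}\to X$; any $p$ with $\delta_{\mathbf X}(p)=x$ is a name of $x$. A realiser of a map $f:\mathbf{X}\to\mathbf{Y}$ is a partial map $R_f:\subseteq\mathbb{N}^{\mathbb{N}}\to\mathbb{N}^{\mathbb{N}}$ sending every name of every $x\in X$ to a name of $f(x)$; $f$ is computable if it has a computable realiser. A computable isomorphism is a computable bijection with computable inverse. $\mathbb{N}$ is represented by $\delta_{\mathbb N}(p)=p(0)$. In the product $\mathbf{X}\times\mathbf{Y}$, $p$ names $(x,y)$ iff $n\mapsto p(2n)$ names $x$ and $n\mapsto p(2n+1)$ names $y$. Sierpinski space $\mathbb{S}=\{\top,\bot\}$ is represented so that $0^\omega$ names $\bot$ and every other sequence names $\top$. A subset of $\mathbf{X}$ is computably open if its characteristic function $\mathbf{X}\to\mathbb{S}$ (value $\top$ exactly on the set) is computable, and computably closed if its complement is computably open. $\mathbf{X}$ is computably discrete (computably Hausdorff) if the diagonal $\{(x,x)\}\subseteq\mathbf{X}\times\mathbf{X}$ is computably open (computably closed). For a transitive relation $\ll$ on $\mathbb{N}$, an ideal is a non-empty $I\subseteq\mathbb{N}$ such that $x\ll y\in I$ implies $x\in I$, and for all $x,y\in I$ there is $z\in I$ with $x\ll z$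 and $y\ll z$. $\mathbf{I}(\ll)$ is the represented space of ideals, where $p$ names $I$ iff $I=\{p(k)\mid k\in\mathbb{N}\}$. A represented space is precomputably Quasi-Polish if it is computably isomorphic to $\mathbf{I}(\ll)$ for some computably enumerable transitive relation $\ll$ on $\mathbb N$. -}

module Defs where

open import Level using (Level; 0ℓ; _⊔_) renaming (suc to lsuc)
open import Data.Bool using (Bool; true; false)
import Data.Bool.Properties as Bool
open import Data.Empty using (⊥-elim)
open import Data.Fin using (Fin)
open import Data.Nat using (ℕ; zero; suc; _+_; _*_; _<_)
import Data.Nat.Properties as ℕ
open import Data.Product using (Σ-syntax; ∃-syntax; _×_; _,_; proj₁)
open import Data.Product.Relation.Binary.Pointwise.NonDependent using (×-setoid)
open import Data.Vec using (Vec; []; _∷_; lookup)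
open import Data.Vec.Relation.Binary.Pointwise.Inductive using (Pointwise)
open import Function using (_∘_)
open import Function.Bundles using (Func; Injection; Inverse; _⇔_)
open import Relation.Binary.Bundles using (Setoid)
open import Relation.Binary.Core using (Rel)
open import Relation.Binary.Definitions using (Transitive)
import Relation.Binary.Construct.On as On
import Relation.Binary.PropositionalEquality.Properties as ≡
open import Relation.Binary.PropositionalEquality
  using (_≡_; _≢_; _≗_; refl; sym; trans; cong)
open import Relation.Unary using (Pred; _∈_; _≐_; ∁)
open import Relation.Unary.Relation.Binary.Equality using (≐-setoid)

private
  variable
    a b ℓ ℓ₁ ℓ₂ : Level
    k m n : ℕ

------------------------------------------------------------------------
-- Partial recursive functions relative to k oracles (Kleene's schemes)

data Rec (k : ℕ) : ℕ → Set where
  zero   : Rec k 0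
  suc    : Rec k 1
  proj   : Fin n → Rec k n
  oracle : Fin k → Rec k 1
  comp   : Rec k m → Vec (Rec k n) m → Rec k n
  prec   : Rec k n → Rec k (2 + n) → Rec k (suc n)
  min    : Rec k (suc n) → Rec k n

Baire : Set
Baire = ℕ → ℕ

infix 4 _⊢_[_]⇓_

-- φ ⊢ f [ xs ]⇓ y : with oracles φ, f is defined at xs, with value y.
data _⊢_[_]⇓_ (φ : Fin k → Baire) : Rec k n → Vec ℕ n → ℕ → Set where
  zero     : φ ⊢ zero [ [] ]⇓ 0
  suc      : ∀ {x} → φ ⊢ suc [ x ∷ [] ]⇓ suc x
  proj     : ∀ {i : Fin n} {xs} → φ ⊢ proj i [ xs ]⇓ lookup xs i
  oracle   : ∀ {i x} → φ ⊢ oracle i [ x ∷ [] ]⇓ φ i x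
  comp     : ∀ {f : Rec k m} {gs : Vec (Rec k n) m} {xs ys z} →
             Pointwise (λ g y → φ ⊢ g [ xs ]⇓ y) gs ys →
             φ ⊢ f [ ys ]⇓ z →
             φ ⊢ comp f gs [ xs ]⇓ z
  prec-zero : ∀ {f : Rec k n} {g xs y} →
             φ ⊢ f [ xs ]⇓ y →
             φ ⊢ prec f g [ 0 ∷ xs ]⇓ y
  prec-suc : ∀ {f : Rec k n} {g xs x y z} →
             φ ⊢ prec f g [ x ∷ xs ]⇓ y →
             φ ⊢ g [ x ∷ y ∷ xs ]⇓ z →
             φ ⊢ prec f g [ suc x ∷ xs ]⇓ z
  min      : ∀ {f : Rec k (suc n)} {xs y} →
             (∀ x → x < y → ∃[ z ] φ ⊢ f [ x ∷ xs ]⇓ suc z) →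
             φ ⊢ f [ y ∷ xs ]⇓ 0 →
             φ ⊢ min f [ xs ]⇓ y

noOracle : Fin 0 → Baire
noOracle ()

-- A relation is c.e. iff it is the domain of a partial recursive function.
ComputablyEnumerable : Rel ℕ ℓ → Set ℓ
ComputablyEnumerable _R_ =
  Σ[ f ∈ Rec 0 2 ]
    (∀ x y → (x R y) ⇔ (∃[ z ] noOracle ⊢ f [ x ∷ y ∷ [] ]⇓ z))

-- The graph of the partial map on Baire space computed by a program with one
-- oracle; it is defined at p when the program, given p, halts on every input.
graph : Rec 1 1 → Baire → Baire → Set
graph f p q = ∀ n → (λ _ → p) ⊢ f [ n ∷ [] ]⇓ q n

------------------------------------------------------------------------
-- Represented spaces

-- The partial surjection δ is given by its graph: p ⊩ x means that p is a name
-- of x.  Sets are setoids, and Baire space carries pointwise equality.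
record RepresentedSpace (a ℓ : Level) : Set (lsuc (a ⊔ ℓ)) where
  infix 4 _⊩_
  field
    setoid : Setoid a ℓ
  open Setoid setoid public using (Carrier; _≈_)
  field
    _⊩_        : Baire → Carrier → Set
    resp       : ∀ {p q x y} → p ≗ q → x ≈ y → p ⊩ x → q ⊩ y
    functional : ∀ {p x y} → p ⊩ x → p ⊩ y → x ≈ y
    surjective : ∀ x → ∃[ p ] p ⊩ x

open RepresentedSpace using (Carrier; setoid)

module _ (X : RepresentedSpace a ℓ₁) (Y : RepresentedSpace b ℓ₂) where
  private
    module X = RepresentedSpace X
    module Y = RepresentedSpace Y

  Realises : (Baire → Baire → Set) → (X.Carrier → Y.Carrier) → Set a
  Realises F f = ∀ x p → p X.⊩ x → ∃[ q ] F p q × q Y.⊩ f x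

  Computable : (X.Carrier → Y.Carrier) → Set a
  Computable f = Σ[ M ∈ Rec 1 1 ] Realises (graph M) f

ComputableInjection : RepresentedSpace a ℓ₁ → RepresentedSpace b ℓ₂ →
  Set (a ⊔ ℓ₁ ⊔ b ⊔ ℓ₂)
ComputableInjection X Y =
  Σ[ ι ∈ Injection (setoid X) (setoid Y) ] Computable X Y (Injection.to ι)

ComputableIsomorphism : RepresentedSpace a ℓ₁ → RepresentedSpace b ℓ₂ →
  Set (a ⊔ ℓ₁ ⊔ b ⊔ ℓ₂)
ComputableIsomorphism X Y =
  Σ[ h ∈ Inverse (setoid X) (setoid Y) ]
    Computable X Y (Inverse.to h) × Computable Y X (Inverse.from h)

naturals : RepresentedSpace 0ℓ 0ℓ
naturals = record
  { setoid     = ≡.setoid ℕ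
  ; _⊩_        = λ p x → p 0 ≡ x
  ; resp       = λ p≗q x≡y p⊩x → trans (sym (p≗q 0)) (trans p⊩x x≡y)
  ; functional = λ p⊩x p⊩y → trans (sym p⊩x) p⊩y
  ; surjective = λ x → (λ _ → x) , refl
  }

-- ⊤ is true and ⊥ is false.
data _NamesInSierpinski_ (p : Baire) : Bool → Set where
  ⊤-name : ∀ n → p n ≢ 0 → p NamesInSierpinski true
  ⊥-name : (∀ n → p n ≡ 0) → p NamesInSierpinski false

Sierpinski : RepresentedSpace 0ℓ 0ℓ
Sierpinski = record
  { setoid     = Bool.≡-setoid
  ; _⊩_        = _NamesInSierpinski_
  ; resp       = resp
  ; functional = functional′
  ; surjective = λ where
      true  → (λ _ → 1) , ⊤-name 0 (λ ())
      false → (λ _ → 0) , ⊥-name (λ _ → refl)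
  }
  where
  resp : ∀ {p q x y} → p ≗ q → x ≡ y →
         p NamesInSierpinski x → q NamesInSierpinski y
  resp p≗q refl (⊤-name n pn≢0) = ⊤-name n (pn≢0 ∘ trans (p≗q n))
  resp p≗q refl (⊥-name p≡0)    = ⊥-name (λ n → trans (sym (p≗q n)) (p≡0 n))

  functional′ : ∀ {p x y} →
                p NamesInSierpinski x → p NamesInSierpinski y → x ≡ y
  functional′ (⊤-name _ _)    (⊤-name _ _)    = refl
  functional′ (⊤-name n pn≢0) (⊥-name p≡0)    = ⊥-elim (pn≢0 (p≡0 n))
  functional′ (⊥-name p≡0)    (⊤-name n pn≢0) = ⊥-elim (pn≢0 (p≡0 n))
  functional′ (⊥-name _)      (⊥-name _)      = refl

evens odds : Baire → Baire
evens p n = p (2 * n)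
odds  p n = p (2 * n + 1)

interleave : Baire → Baire → Baire
interleave p q zero    = p 0
interleave p q (suc n) = interleave q (p ∘ suc) n

evens-interleave : ∀ p q → p ≗ evens (interleave p q)
evens-interleave p q zero    = refl
evens-interleave p q (suc n) =
  trans (evens-interleave (p ∘ suc) (q ∘ suc) n)
        (cong (interleave p q) (sym (ℕ.*-suc 2 n)))

odds-interleave : ∀ p q → q ≗ odds (interleave p q)
odds-interleave p q n =
  trans (evens-interleave q (p ∘ suc) n)
        (cong (interleave p q) (ℕ.+-comm 1 (2 * n)))

infixr 2 _⊗_

_⊗_ : RepresentedSpace a ℓ₁ → RepresentedSpace b ℓ₂ →
      RepresentedSpace (a ⊔ b) (ℓ₁ ⊔ ℓ₂)
X ⊗ Y = record
  { setoid     = ×-setoid X.setoid Y.setoid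
  ; _⊩_        = λ p (x , y) → evens p X.⊩ x × odds p Y.⊩ y
  ; resp       = λ p≗q (x≈x′ , y≈y′) (p⊩x , p⊩y) →
      X.resp (λ n → p≗q (2 * n)) x≈x′ p⊩x ,
      Y.resp (λ n → p≗q (2 * n + 1)) y≈y′ p⊩y
  ; functional = λ (p⊩x , p⊩y) (p⊩x′ , p⊩y′) →
      X.functional p⊩x p⊩x′ , Y.functional p⊩y p⊩y′
  ; surjective = λ (x , y) →
      let p , p⊩x = X.surjective x
          q , q⊩y = Y.surjective y
      in interleave p q ,
         X.resp (evens-interleave p q) (Setoid.refl X.setoid) p⊩x ,
         Y.resp (odds-interleave p q) (Setoid.refl Y.setoid) q⊩y
  }
  where
  module X = RepresentedSpace X
  module Y = RepresentedSpace Y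

module _ (X : RepresentedSpace a ℓ₁) where
  private module X = RepresentedSpace X

  ComputablyOpen : Pred X.Carrier ℓ → Set (a ⊔ ℓ₁ ⊔ ℓ)
  ComputablyOpen U =
    Σ[ χ ∈ Func (setoid X) (setoid Sierpinski) ]
      (∀ x → Func.to χ x ≡ true ⇔ x ∈ U) × Computable X Sierpinski (Func.to χ)

  ComputablyClosed : Pred X.Carrier ℓ → Set (a ⊔ ℓ₁ ⊔ ℓ)
  ComputablyClosed A = ComputablyOpen (∁ A)

module _ (X : RepresentedSpace a ℓ) where
  private module X = RepresentedSpace X

  Diagonal : Pred (Carrier (X ⊗ X)) ℓ
  Diagonal (x , y) = x X.≈ y

  ComputablyDiscrete : Set (a ⊔ ℓ)
  ComputablyDiscrete = ComputablyOpen (X ⊗ X) Diagonal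

  ComputablyHausdorff : Set (a ⊔ ℓ)
  ComputablyHausdorff = ComputablyClosed (X ⊗ X) Diagonal

------------------------------------------------------------------------
-- Spaces of ideals

record IsIdeal (_≪_ : Rel ℕ 0ℓ) (I : Pred ℕ 0ℓ) : Set where
  field
    nonempty : ∃[ x ] x ∈ I
    lower    : ∀ {x y} → x ≪ y → y ∈ I → x ∈ I
    directed : ∀ {x y} → x ∈ I → y ∈ I → ∃[ z ] z ∈ I × x ≪ z × y ≪ z

range : Baire → Pred ℕ 0ℓ
range p x = ∃[ i ] p i ≡ x

-- Classically every non-empty set of numbers is the range of some sequence, so
-- the last component excludes no ideal.  Constructively this has to be asked
-- for: the points of a represented space are those that have a name.
Ideal : Rel ℕ 0ℓ → Set₁
Ideal _≪_ = Σ[ I ∈ Pred ℕ 0ℓ ] IsIdeal _≪_ I × ∃[ p ] I ≐ range p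

Ideals : Rel ℕ 0ℓ → RepresentedSpace (lsuc 0ℓ) 0ℓ
Ideals _≪_ = record
  { setoid     = On.setoid {B = Ideal _≪_} (≐-setoid ℕ 0ℓ) proj₁
  ; _⊩_        = λ p (I , _) → I ≐ range p
  ; resp       = λ p≗q I≐J I≐p →
      S.trans (S.sym I≐J) (S.trans I≐p (range-cong p≗q))
  ; functional = λ I≐p J≐p → S.trans I≐p (S.sym J≐p)
  ; surjective = λ (_ , _ , named) → named
  }
  where
  module S = Setoid (≐-setoid ℕ 0ℓ)

  range-cong : ∀ {p q} → p ≗ q → range p ≐ range q
  range-cong p≗q = (λ (i , e) → i , trans (sym (p≗q i)) e) ,
                   (λ (i , e) → i , trans (p≗q i) e)

PrecomputablyQuasiPolish : RepresentedSpace a ℓ → Set (lsuc 0ℓ ⊔ a ⊔ ℓ)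
PrecomputablyQuasiPolish X =
  Σ[ ≪ ∈ Rel ℕ 0ℓ ]
    Transitive ≪ × ComputablyEnumerable ≪ ×
    ComputableIsomorphism X (Ideals ≪)

{-# OPTIONS --safe #-}

-- For every code e of a program the space has a part X_e on which that program
-- computes no injection.  X_e is built from two chains of basic open sets, of
-- kinds 0 and 1.  As long as the program has not halted on the name that lists
-- chain 0, X_e is one point, named by chain 0.  Once it has halted there, chain 0
-- alone names nothing any more and X_e is one point named by chain 1, until the
-- program halts on that name too.  If the two values are then equal, the chains
-- become two points, and the program is not injective; if they differ, the chains
-- become a single point, and the program is not well defined.
--
-- Names beginning with the same kind name the same point.  If points arise from
-- both kinds, the program has halted on both chains, and comparing its two values
-- decides whether they are equal, so equality and inequality are semidecidable.
--
-- The construction only needs a universal machine that halts with the right value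
-- whenever the simulated program halts; its behaviour otherwise is irrelevant.

module Submission where

open import Defs
open import Level using (0ℓ) renaming (suc to lsuc)
open import Data.Bool using (true)
open import Data.Empty using (⊥; ⊥-elim)
open import Data.Fin using (Fin; zero; suc; #_)
open import Data.List using (List; []; _∷_)
open import Data.Nat
  using (ℕ; zero; suc; pred; _+_; _*_; _∸_; ∣_-_∣; _≤_; _<_; z≤n; s≤s; _≟_; _⊔_)
open import Data.Nat.Properties
open import Data.Product using (Σ-syntax; ∃-syntax; _×_; _,_; proj₁; proj₂)
open import Data.Sum using (_⊎_; inj₁; inj₂; [_,_]′)
open import Data.Vec using (Vec; []; _∷_; lookup)
open import Data.Vec.Relation.Binary.Pointwise.Inductive using (Pointwise; []; _∷_)
open import Function using (_∘_; id)
open import Function.Bundles using (Func; Injection; Equivalence; _⇔_; mk⇔)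
open import Function.Construct.Identity using (inverse)
open import Relation.Binary.Core using (Rel)
open import Relation.Binary.Definitions using (Transitive; tri<; tri≈; tri>)
open import Relation.Binary.PropositionalEquality
open import Relation.Nullary using (¬_; Dec; yes; no; contradiction)
open import Relation.Nullary.Decidable using (does; does-⇔; ¬?; decidable-stable)
open import Relation.Unary using (Pred; _∈_; _≐_; _⊆_; ∁)
open import Relation.Unary.Properties using (≐-sym)

private
  variable
    k m n : ℕ
    φ : Fin k → Baire

-- Evaluation is deterministic

⇓-deterministic : ∀ {f : Rec k n} {xs y z} →
                  φ ⊢ f [ xs ]⇓ y → φ ⊢ f [ xs ]⇓ z → y ≡ z
⇓-deterministic* : ∀ {fs : Vec (Rec k n) m} {xs ys zs} →
                   Pointwise (λ f y → φ ⊢ f [ xs ]⇓ y) fs ys →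
                   Pointwise (λ f y → φ ⊢ f [ xs ]⇓ y) fs zs → ys ≡ zs
-- The evidence supplied by `min` is passed still packed in its existential; opening it here yields
-- a structurally smaller derivation, so the mutual recursion terminates.
0≢suc : ∀ {f : Rec k n} {xs} →
        φ ⊢ f [ xs ]⇓ 0 → ∃[ z ] φ ⊢ f [ xs ]⇓ suc z → ⊥
suc≢0 : ∀ {f : Rec k n} {xs} →
        ∃[ z ] φ ⊢ f [ xs ]⇓ suc z → φ ⊢ f [ xs ]⇓ 0 → ⊥

⇓-deterministic zero zero = refl
⇓-deterministic suc suc = refl
⇓-deterministic proj proj = refl
⇓-deterministic oracle oracle = refl
⇓-deterministic (comp ds d) (comp es e)
  with refl ← ⇓-deterministic* ds es = ⇓-deterministic d e
⇓-deterministic (prec-zero d) (prec-zero e) = ⇓-deterministic d e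
⇓-deterministic (prec-suc d d′) (prec-suc e e′)
  with refl ← ⇓-deterministic d e = ⇓-deterministic d′ e′
⇓-deterministic (min {y = y} h d) (min {y = z} h′ e) with <-cmp y z
... | tri< y<z _ _ = ⊥-elim (0≢suc d (h′ y y<z))
... | tri≈ _ y≡z _ = y≡z
... | tri> _ _ z<y = ⊥-elim (suc≢0 (h z z<y) e)

⇓-deterministic* [] [] = refl
⇓-deterministic* (d ∷ ds) (e ∷ es) =
  cong₂ _∷_ (⇓-deterministic d e) (⇓-deterministic* ds es)

0≢suc d (_ , e) with () ← ⇓-deterministic d e
suc≢0 (_ , d) e with () ← ⇓-deterministic d e

-- Total programs

-- Polymorphic in the number of oracles, so that one term serves both in an enumeration without
-- oracles and in a realiser with one.
record Term (n : ℕ) : Set where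
  field
    program  : ∀ {k} → Rec k n
    ⟦_⟧      : Vec ℕ n → ℕ
    computes : ∀ {k} {φ : Fin k → Baire} xs → φ ⊢ program [ xs ]⇓ ⟦_⟧ xs

open Term

programs : Vec (Term n) m → Vec (Rec k n) m
programs []       = []
programs (t ∷ ts) = program t ∷ programs ts

⟦_⟧* : Vec (Term n) m → Vec ℕ n → Vec ℕ m
⟦ [] ⟧*     xs = []
⟦ t ∷ ts ⟧* xs = ⟦ t ⟧ xs ∷ ⟦ ts ⟧* xs

computes* : ∀ (ts : Vec (Term n) m) xs →
            Pointwise (λ f y → φ ⊢ f [ xs ]⇓ y) (programs ts) (⟦ ts ⟧* xs)
computes* []       xs = []
computes* (t ∷ ts) xs = computes t xs ∷ computes* ts xs

app : Term m → Vec (Term n) m → Term n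
app t ts = record
  { program  = comp (program t) (programs ts)
  ; ⟦_⟧      = λ xs → ⟦ t ⟧ (⟦ ts ⟧* xs)
  ; computes = λ xs → comp (computes* ts xs) (computes t _)
  }

var : Fin n → Term n
var i = record
  { program = proj i ; ⟦_⟧ = λ xs → lookup xs i ; computes = λ _ → proj }

numeral : ℕ → Rec k n
numeral zero    = comp zero []
numeral (suc x) = comp suc (numeral x ∷ [])

numeral-⇓ : ∀ x {xs : Vec ℕ n} → φ ⊢ numeral x [ xs ]⇓ x
numeral-⇓ zero    = comp [] zero
numeral-⇓ (suc x) = comp (numeral-⇓ x ∷ []) suc

lit : ℕ → Term n
lit x = record
  { program = numeral x ; ⟦_⟧ = λ _ → x ; computes = λ _ → numeral-⇓ x }

primrec : (Vec ℕ n → ℕ) → (Vec ℕ (2 + n) → ℕ) → ℕ → Vec ℕ n → ℕ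
primrec f g zero    xs = f xs
primrec f g (suc x) xs = g (x ∷ primrec f g x xs ∷ xs)

primrecTerm : Term n → Term (2 + n) → Term (suc n)
primrecTerm {n} f g = record
  { program  = prec (program f) (program g)
  ; ⟦_⟧      = λ { (x ∷ xs) → primrec ⟦ f ⟧ ⟦ g ⟧ x xs }
  ; computes = λ { (x ∷ xs) → go x xs }
  }
  where
  go : ∀ x (xs : Vec ℕ n) →
       φ ⊢ prec (program f) (program g) [ x ∷ xs ]⇓ primrec ⟦ f ⟧ ⟦ g ⟧ x xs
  go zero    xs = prec-zero (computes f xs)
  go (suc x) xs = prec-suc (go x xs) (computes g _)

-- Replaces the meaning of a term by an extensionally equal function, so that meanings of larger
-- terms reduce to ordinary arithmetic instead of nested `primrec`.
term₁ : (f : ℕ → ℕ) (t : Term 1) → (∀ x → ⟦ t ⟧ (x ∷ []) ≡ f x) → Term 1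
term₁ f t t≗f = record
  { program  = program t
  ; ⟦_⟧      = λ xs → f (lookup xs zero)
  ; computes = λ { xs@(x ∷ []) →
      subst (_ ⊢ program t [ xs ]⇓_) (t≗f x) (computes t xs) }
  }

term₂ : (f : ℕ → ℕ → ℕ) (t : Term 2) →
        (∀ x y → ⟦ t ⟧ (x ∷ y ∷ []) ≡ f x y) → Term 2
term₂ f t t≗f = record
  { program  = program t
  ; ⟦_⟧      = λ xs → f (lookup xs zero) (lookup xs (suc zero))
  ; computes = λ { xs@(x ∷ y ∷ []) →
      subst (_ ⊢ program t [ xs ]⇓_) (t≗f x y) (computes t xs) }
  }

sucTerm : Term 1
sucTerm = record
  { program  = suc
  ; ⟦_⟧      = λ xs → suc (lookup xs zero)
  ; computes = λ { (_ ∷ []) → suc }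
  }

`suc : Term n → Term n
`suc t = app sucTerm (t ∷ [])

infixl 6 _`+_ _`∸_
infixl 7 _`*_

_`+_ : Term n → Term n → Term n
s `+ t = app (term₂ _+_ +-term +-correct) (s ∷ t ∷ [])
  where
  +-term : Term 2
  +-term = primrecTerm (var (# 0)) (`suc (var (# 1)))

  +-correct : ∀ x y → ⟦ +-term ⟧ (x ∷ y ∷ []) ≡ x + y
  +-correct zero    y = refl
  +-correct (suc x) y = cong suc (+-correct x y)

_`*_ : Term n → Term n → Term n
s `* t = app (term₂ _*_ *-term *-correct) (s ∷ t ∷ [])
  where
  *-term : Term 2
  *-term = primrecTerm (lit 0) (var (# 2) `+ var (# 1))

  *-correct : ∀ x y → ⟦ *-term ⟧ (x ∷ y ∷ []) ≡ x * y
  *-correct zero    y = refl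
  *-correct (suc x) y = cong (y +_) (*-correct x y)

`pred : Term n → Term n
`pred t = app (term₁ pred pred-term pred-correct) (t ∷ [])
  where
  pred-term : Term 1
  pred-term = primrecTerm (lit 0) (var (# 0))

  pred-correct : ∀ x → ⟦ pred-term ⟧ (x ∷ []) ≡ pred x
  pred-correct zero    = refl
  pred-correct (suc x) = refl

_`∸_ : Term n → Term n → Term n
-- Recursion runs on the first argument, so `∸-term` takes the subtrahend first and the variables
-- are swapped.
s `∸ t = app (term₂ _∸_ (app ∸-term (var (# 1) ∷ var (# 0) ∷ []))
                        (λ x y → ∸-correct y x)) (s ∷ t ∷ [])
  where
  ∸-term : Term 2
  ∸-term = primrecTerm (var (# 0)) (`pred (var (# 1)))

  ∸-correct : ∀ y x → ⟦ ∸-term ⟧ (y ∷ x ∷ []) ≡ x ∸ y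
  ∸-correct zero    x = refl
  ∸-correct (suc y) x =
    trans (cong pred (∸-correct y x)) (pred[m∸n]≡m∸[1+n] x y)

`∣_-_∣ : Term n → Term n → Term n
`∣ s - t ∣ = app (term₂ ∣_-_∣ ((x `∸ y) `+ (y `∸ x)) correct) (s ∷ t ∷ [])
  where
  x y : Term 2
  x = var (# 0)
  y = var (# 1)

  correct : ∀ x y → (x ∸ y) + (y ∸ x) ≡ ∣ x - y ∣
  correct zero    zero    = refl
  correct zero    (suc y) = refl
  correct (suc x) zero    = +-identityʳ (suc x)
  correct (suc x) (suc y) = correct x y

ifz_then_else_ : ℕ → ℕ → ℕ → ℕ
ifz zero  then x else y = x
ifz suc _ then x else y = y

`ifz_then_else_ : Term n → Term n → Term n → Term n
`ifz b then s else t = app if-term (b ∷ s ∷ t ∷ [])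
  where
  rec-term : Term 3
  rec-term = primrecTerm (var (# 0)) (var (# 3))

  rec-correct : ∀ b x y → ⟦ rec-term ⟧ (b ∷ x ∷ y ∷ []) ≡ ifz b then x else y
  rec-correct zero    x y = refl
  rec-correct (suc b) x y = refl

  if-term : Term 3
  if-term = record
    { program  = program rec-term
    ; ⟦_⟧      = λ xs → ifz lookup xs (# 0) then lookup xs (# 1) else lookup xs (# 2)
    ; computes = λ { xs@(b ∷ x ∷ y ∷ []) →
        subst (_ ⊢ program rec-term [ xs ]⇓_) (rec-correct b x y)
              (computes rec-term xs) }
    }

switch : ℕ → List ℕ → ℕ
switch i []       = 0
switch i (x ∷ xs) = ifz i then x else switch (pred i) xs

`switch : Term n → List (Term n) → Term n
`switch i []       = lit 0
`switch i (t ∷ ts) = `ifz i then t else `switch (`pred i) ts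

-- Cantor's pairing function

triangle : ℕ → ℕ
triangle zero    = 0
triangle (suc n) = suc n + triangle n

triangle-mono : ∀ {m n} → m ≤ n → triangle m ≤ triangle n
triangle-mono z≤n       = z≤n
triangle-mono (s≤s m≤n) = +-mono-≤ (s≤s m≤n) (triangle-mono m≤n)

-- The largest `r` with `triangle r ≤ n`; from `n` to `suc n` it grows by at most one.
root : ℕ → ℕ
root zero    = 0
root (suc n) =
  ifz triangle (suc (root n)) ∸ suc n then suc (root n) else root n

root-bounds : ∀ n → triangle (root n) ≤ n × n < triangle (suc (root n))
root-bounds zero = z≤n , s≤s z≤n
root-bounds (suc n)
  with root-bounds n | triangle (suc (root n)) ∸ suc n in eq
... | _ , n<t | zero  =
  m∸n≡0⇒m≤n eq , s≤s (≤-trans n<t (m≤n+m _ (suc (root n))))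
... | t≤n , n<t | suc d =
  m≤n⇒m≤1+n t≤n ,
  ≰⇒> (λ t≤1+n → 0≢1+n (trans (sym (m≤n⇒m∸n≡0 t≤1+n)) eq))

root-unique : ∀ {r s n} → triangle r ≤ n → n < triangle (suc r) →
              triangle s ≤ n → n < triangle (suc s) → r ≡ s
root-unique {r} {s} t≤n n<t t≤n′ n<t′ with <-cmp r s
... | tri< r<s _ _ = contradiction (≤-trans (triangle-mono r<s) t≤n′) (<⇒≱ n<t)
... | tri≈ _ r≡s _ = r≡s
... | tri> _ _ s<r = contradiction (≤-trans (triangle-mono s<r) t≤n) (<⇒≱ n<t′)

opaque
  pair : ℕ → ℕ → ℕ
  pair x y = triangle (x + y) + x

  fst snd : ℕ → ℕ
  fst n = n ∸ triangle (root n)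
  snd n = root n ∸ fst n

  -- Outside the opaque block `pair`, `fst` and `snd` do not reduce; these three equations connect
  -- them to their terms there.
  pair-def : ∀ x y → triangle (x + y) + x ≡ pair x y
  pair-def x y = refl

  fst-def : ∀ n → n ∸ triangle (root n) ≡ fst n
  fst-def n = refl

  snd-def : ∀ n → root n ∸ fst n ≡ snd n
  snd-def n = refl

  -- Since `x ≤ x + y`, the code of the pair stays below the next triangular number.
  root-pair : ∀ x y → root (pair x y) ≡ x + y
  root-pair x y = root-unique
    (proj₁ (root-bounds (pair x y))) (proj₂ (root-bounds (pair x y)))
    (m≤m+n _ x) (≤-<-trans (+-monoʳ-≤ (triangle (x + y)) (m≤m+n x y))
                           (subst (_< triangle (suc (x + y)))
                                  (+-comm (x + y) (triangle (x + y))) ≤-refl))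

  fst-pair : ∀ x y → fst (pair x y) ≡ x
  fst-pair x y rewrite root-pair x y = m+n∸m≡n (triangle (x + y)) x

  snd-pair : ∀ x y → snd (pair x y) ≡ y
  snd-pair x y rewrite fst-pair x y | root-pair x y = m+n∸m≡n x y

  pair-fst-snd : ∀ n → pair (fst n) (snd n) ≡ n
  pair-fst-snd n = trans
    (cong (λ r → triangle r + fst n) (m+[n∸m]≡n fst≤root))
    (trans (+-comm (triangle (root n)) (fst n)) (m∸n+n≡m (proj₁ (root-bounds n))))
    where
    fst≤root : fst n ≤ root n
    fst≤root = subst (fst n ≤_) (m+n∸n≡m (root n) (triangle (root n)))
      (∸-monoˡ-≤ (triangle (root n)) (≤-pred (proj₂ (root-bounds n))))

`triangle : Term n → Term n
`triangle t = app (term₁ triangle triangle-term correct) (t ∷ [])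
  where
  triangle-term : Term 1
  triangle-term = primrecTerm (lit 0) (`suc (var (# 0)) `+ var (# 1))

  correct : ∀ x → ⟦ triangle-term ⟧ (x ∷ []) ≡ triangle x
  correct zero    = refl
  correct (suc x) = cong (suc x +_) (correct x)

`root : Term n → Term n
`root t = app (term₁ root root-term correct) (t ∷ [])
  where
  root-term : Term 1
  root-term = primrecTerm (lit 0)
    (`ifz `triangle (`suc (var (# 1))) `∸ `suc (var (# 0))
     then `suc (var (# 1)) else var (# 1))

  correct : ∀ x → ⟦ root-term ⟧ (x ∷ []) ≡ root x
  correct zero    = refl
  correct (suc x) =
    cong (λ r → ifz triangle (suc r) ∸ suc x then suc r else r) (correct x)

`pair : Term n → Term n → Term n
`pair s t = app (term₂ pair (`triangle (var (# 0) `+ var (# 1)) `+ var (# 0)) pair-def)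
                (s ∷ t ∷ [])

`fst : Term n → Term n
`fst t = app (term₁ fst (var (# 0) `∸ `triangle (`root (var (# 0)))) fst-def) (t ∷ [])

`snd : Term n → Term n
`snd t = app (term₁ snd (`root (var (# 0)) `∸ `fst (var (# 0))) snd-def) (t ∷ [])

-- Parity and halving

parity : ℕ → ℕ
parity zero    = 0
parity (suc n) = 1 ∸ parity n

parity-binary : ∀ n → parity n ≡ 0 ⊎ parity n ≡ 1
parity-binary zero = inj₁ refl
parity-binary (suc n) with parity n | parity-binary n
... | _ | inj₁ refl = inj₂ refl
... | _ | inj₂ refl = inj₁ refl

parity-double : ∀ n → parity (n + n) ≡ 0
parity-double zero = refl
parity-double (suc n) rewrite +-suc n n | parity-double n = refl

parity-half : ∀ n → ∃[ h ] parity n + (h + h) ≡ n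
parity-half zero = 0 , refl
parity-half (suc n) with parity n | parity-binary n | parity-half n
... | _ | inj₁ refl | h , eq = h , cong suc eq
... | _ | inj₂ refl | h , eq = suc h , cong suc (trans (+-suc h h) eq)

`parity : Term n → Term n
`parity t = app (term₁ parity parity-term correct) (t ∷ [])
  where
  parity-term : Term 1
  parity-term = primrecTerm (lit 0) (lit 1 `∸ var (# 1))

  correct : ∀ x → ⟦ parity-term ⟧ (x ∷ []) ≡ parity x
  correct zero    = refl
  correct (suc x) = cong (1 ∸_) (correct x)

-- A universal machine

-- A configuration pair (pair P K) v is about to run the instruction P on the
-- value v, with the list K of instructions still to come.

Halt Id Zero Suc Fst Snd Query : ℕ
Halt  = pair 0 0
Id    = pair 1 0
Zero  = pair 2 0
Suc   = pair 3 0
Fst   = pair 4 0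
Snd   = pair 5 0
Query = pair 6 0

-- Fork₂ and Cons occur only in the control list: they are the pending parts
-- of a Fork.

Seq Fork Fork₂ : ℕ → ℕ → ℕ
Seq   P Q = pair 7 (pair P Q)
Fork  P Q = pair 8 (pair P Q)
Fork₂ v Q = pair 10 (pair v Q)

While Cons : ℕ → ℕ
While P = pair 9 P
Cons  v = pair 11 v

-- At time s an oracle query at v ≥ s waits, so that the configuration at time
-- s depends on the first s values of the oracle only.

execute : Baire → (s op arg K v : ℕ) → ℕ
execute p s op arg K v = switch op
  -- The entries follow the opcodes 0 to 11. `Halt` reproduces its configuration, so a halted run is
  -- stationary.
  ( pair (pair (pair op arg) K) v
  ∷ pair K v
  ∷ pair K 0
  ∷ pair K (suc v)
  ∷ pair K (fst v)
  ∷ pair K (snd v)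
  ∷ (ifz suc v ∸ s then pair K (p v) else pair (pair (pair op arg) K) v)
  ∷ pair (pair (fst arg) (pair (snd arg) K)) v
  ∷ pair (pair (fst arg) (pair (Fork₂ v (snd arg)) K)) v
  -- `While` reads its counter from the first component of the value; the body receives the counter
  -- already decremented.
  ∷ (ifz fst v then pair K (snd v)
     else pair (pair arg (pair (While arg) K)) (pair (pred (fst v)) (snd v)))
  ∷ pair (pair (snd arg) (pair (Cons v) K)) (fst arg)
  ∷ pair K (pair arg v)
  ∷ [])

step : Baire → ℕ → ℕ → ℕ
step p s c =
  execute p s (fst (fst (fst c))) (snd (fst (fst c))) (snd (fst c)) (snd c)

-- The input `pair 0 0` encodes the argument list `0 ∷ []`: a name of a natural number is read at
-- position 0 only.
start : ℕ → ℕ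
start P = pair (pair P (pair Halt 0)) (pair 0 0)

run : Baire → ℕ → ℕ → ℕ
run p P zero    = start P
run p P (suc s) = step p s (run p P s)

-- The machine has halted when running is zero.

running : ℕ → ℕ
running c = fst (fst (fst c))

step-pair : ∀ p s op arg K v →
            step p s (pair (pair (pair op arg) K) v) ≡ execute p s op arg K v
step-pair p s op arg K v
  rewrite fst-pair (pair (pair op arg) K) v | snd-pair (pair (pair op arg) K) v
        | fst-pair (pair op arg) K | snd-pair (pair op arg) K
        | fst-pair op arg | snd-pair op arg = refl

-- `Halt` rebuilds the configuration from its components, and `pair` inverts `fst` and `snd` on
-- every number, so `c` may be arbitrary.
step-halted : ∀ p s c → running c ≡ 0 → step p s c ≡ c
step-halted p s c halted rewrite halted = trans
  (cong (λ I → pair (pair I (snd (fst c))) (snd c))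
        (trans (cong (λ op → pair op (snd (fst (fst c)))) (sym halted))
               (pair-fst-snd (fst (fst c)))))
  (trans (cong (λ C → pair C (snd c)) (pair-fst-snd (fst c))) (pair-fst-snd c))

run-halted : ∀ p P {s t} → s ≤ t → running (run p P s) ≡ 0 →
             run p P t ≡ run p P s
run-halted p P {s} {t} s≤t halted =
  subst (λ u → run p P u ≡ run p P s) (m∸n+n≡m s≤t) (go (t ∸ s))
  where
  go : ∀ d → run p P (d + s) ≡ run p P s
  go zero    = refl
  go (suc d) = trans
    (step-halted p (d + s) _ (trans (cong running (go d)) halted)) (go d)

run-halted-unique : ∀ p P {s t} → running (run p P s) ≡ 0 →
                    running (run p P t) ≡ 0 → run p P s ≡ run p P t
run-halted-unique p P {s} {t} hs ht with ≤-total s t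
... | inj₁ s≤t = sym (run-halted p P s≤t hs)
... | inj₂ t≤s = run-halted p P t≤s ht

-- A query at `v` is answered only at times beyond `v`. A run that has halted by time `t` thus
-- carries over to every oracle with the same first `t` values.
run-cong : ∀ {p q} P t → (∀ v → v < t → p v ≡ q v) → run p P t ≡ run q P t
run-cong P zero p≗q = refl
run-cong {p} {q} P (suc t) p≗q
  rewrite run-cong P t (λ v v<t → p≗q v (m≤n⇒m≤1+n v<t))
  = step-cong (run q P t)
  where
  query-cong : ∀ v K w → (ifz suc v ∸ t then pair K (p v) else w) ≡
                         (ifz suc v ∸ t then pair K (q v) else w)
  query-cong v K w with suc v ∸ t in eq
  ... | zero  = cong (pair K) (p≗q v (m≤n⇒m≤1+n (m∸n≡0⇒m≤n eq)))
  ... | suc _ = refl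

  step-cong : ∀ c → step p t c ≡ step q t c
  step-cong c
    rewrite query-cong (snd c) (snd (fst c))
              (pair (pair (pair (fst (fst (fst c))) (snd (fst (fst c)))) (snd (fst c)))
                    (snd c)) = refl

-- Correctness of the single instructions

module _ (p : Baire) (P₀ : ℕ) where

  -- Quantified over the time `s` at which `c` occurs, since a step may depend on the time through a
  -- waiting query.
  Reaches : ℕ → ℕ → Set
  Reaches c d = ∀ s → run p P₀ s ≡ c → ∃[ t ] run p P₀ t ≡ d

  infixr 5 _⨾_

  _⨾_ : ∀ {c d e} → Reaches c d → Reaches d e → Reaches c e
  (r ⨾ r′) s eq = let t , eq′ = r s eq in r′ t eq′

  step-reaches : ∀ {op arg K v d} → (∀ s → execute p s op arg K v ≡ d) →
                 Reaches (pair (pair (pair op arg) K) v) d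
  step-reaches {op} {arg} {K} {v} ex s eq = suc s ,
    trans (cong (step p s) eq) (trans (step-pair p s op arg K v) (ex s))

  Runs : ℕ → ℕ → ℕ → Set
  Runs P v w = ∀ K → Reaches (pair (pair P K) v) (pair K w)

  runs-Id : ∀ {v} → Runs Id v v
  runs-Id K = step-reaches (λ _ → refl)

  runs-Zero : ∀ {v} → Runs Zero v 0
  runs-Zero K = step-reaches (λ _ → refl)

  runs-Suc : ∀ {v} → Runs Suc v (suc v)
  runs-Suc K = step-reaches (λ _ → refl)

  runs-Fst : ∀ {v w} → Runs Fst (pair v w) v
  runs-Fst {v} {w} K = step-reaches (λ _ → cong (pair K) (fst-pair v w))

  runs-Snd : ∀ {v w} → Runs Snd (pair v w) w
  runs-Snd {v} {w} K = step-reaches (λ _ → cong (pair K) (snd-pair v w))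

  runs-Query : ∀ {v} → Runs Query v (p v)
  runs-Query {v} K s eq = wait (suc v) s (m≤m+n (suc v) s) eq
    where
    -- `d` bounds the waiting still to come: each idle step raises `s` by one, and at `d = 0` the
    -- query can no longer wait.
    wait : ∀ d s → suc v ≤ d + s → run p P₀ s ≡ pair (pair Query K) v →
           ∃[ t ] run p P₀ t ≡ pair K (p v)
    wait d s v<d+s eq with suc v ∸ s in v∸s | step-pair p s 6 0 K v
    wait d s v<d+s eq | zero | st =
      suc s , trans (cong (step p s) eq) st
    wait zero s v<s eq | suc _ | st =
      contradiction (trans (sym (m≤n⇒m∸n≡0 v<s)) v∸s) 0≢1+n
    wait (suc d) s v<d+s eq | suc _ | st =
      wait d (suc s) (subst (suc v ≤_) (sym (+-suc d s)) v<d+s)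
           (trans (cong (step p s) eq) st)

  runs-Seq : ∀ {P Q u v w} → Runs P u v → Runs Q v w → Runs (Seq P Q) u w
  runs-Seq {P} {Q} {u} rP rQ K =
    step-reaches (λ _ → cong₂ (λ P Q → pair (pair P (pair Q K)) u)
                              (fst-pair P Q) (snd-pair P Q))
    ⨾ rP _ ⨾ rQ K

  runs-Fork : ∀ {P Q u v w} → Runs P u v → Runs Q u w →
              Runs (Fork P Q) u (pair v w)
  runs-Fork {P} {Q} {u} {v} rP rQ K =
    step-reaches (λ _ → cong₂ (λ P Q → pair (pair P (pair (Fork₂ u Q) K)) u)
                              (fst-pair P Q) (snd-pair P Q))
    ⨾ rP _
    ⨾ step-reaches (λ _ → cong₂ (λ u Q → pair (pair Q (pair (Cons v) K)) u)
                                (fst-pair u Q) (snd-pair u Q))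
    ⨾ rQ _
    ⨾ step-reaches (λ _ → refl)

  runs-While-zero : ∀ {P v} → Runs (While P) (pair 0 v) v
  runs-While-zero {P} {v} K = step-reaches
    (λ _ → trans
      (cong (λ c → ifz c then pair K (snd (pair 0 v))
                   else pair (pair P (pair (While P) K)) (pair (pred c) (snd (pair 0 v))))
            (fst-pair 0 v))
      (cong (pair K) (snd-pair 0 v)))

  runs-While-suc : ∀ {P c v u w} → Runs P (pair c v) u → Runs (While P) u w →
                   Runs (While P) (pair (suc c) v) w
  runs-While-suc {P} {c} {v} rP rW K =
    step-reaches
      (λ _ → cong₂ (λ c v → ifz c then pair K v
                            else pair (pair P (pair (While P) K)) (pair (pred c) v))
                   (fst-pair (suc c) v) (snd-pair (suc c) v))
    ⨾ rP _ ⨾ rW K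

-- Compilation of programs with one oracle

encode : Vec ℕ n → ℕ
encode []       = 0
encode (x ∷ xs) = pair x (encode xs)

-- The counter, the index, the last value and the parameters of a recursion
-- are kept as pair c (pair i (pair y (encode xs))).

recursionStart recursionStep : ℕ → ℕ
recursionStart P = Fork Fst (Fork Zero (Fork (Seq Snd P) Snd))
recursionStep  P = Fork Fst (Seq Snd (Fork (Seq Fst Suc) (Fork P (Seq Snd Snd))))

recursion : ℕ → ℕ → ℕ
recursion P Q = Seq (recursionStart P) (While (recursionStep Q))

-- The loop counter is the latest value of the tested function, so the loop stops exactly at a zero.
-- The body drops the decremented counter, increments the argument and tests again.
searchStep : ℕ → ℕ
searchStep P = Seq Snd (Seq (Fork (Seq Fst Suc) Snd) (Fork P Id))

projection : Fin n → ℕ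
projection zero    = Fst
projection (suc i) = Seq Snd (projection i)

compile  : Rec 1 n → ℕ
compile* : Vec (Rec 1 n) m → ℕ

compile zero       = Zero
compile suc        = Seq Fst Suc
compile (proj i)   = projection i
compile (oracle _) = Seq Fst Query
compile (comp f gs) = Seq (compile* gs) (compile f)
compile (prec f g)  =
  Seq (recursion (compile f) (compile g)) (Seq Snd Fst)
compile (min f) =
  Seq (Fork Zero Id)
  (Seq (Fork (compile f) Id) (Seq (While (searchStep (compile f))) Fst))

compile* []       = Zero
compile* (g ∷ gs) = Fork (compile g) (compile* gs)

module _ (p : Baire) (P₀ : ℕ) where

  private
    infix 4 _runs_⇒_

    _runs_⇒_ : ℕ → ℕ → ℕ → Set
    P runs v ⇒ w = Runs p P₀ P v w

  projection-runs : ∀ (i : Fin n) xs → projection i runs encode xs ⇒ lookup xs i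
  projection-runs zero    (x ∷ xs) = runs-Fst p P₀
  projection-runs (suc i) (x ∷ xs) =
    runs-Seq p P₀ (runs-Snd p P₀) (projection-runs i xs)

  compile-runs : ∀ {f : Rec 1 n} {xs y} → (λ _ → p) ⊢ f [ xs ]⇓ y →
                 compile f runs encode xs ⇒ y
  compile*-runs : ∀ {fs : Vec (Rec 1 n) m} {xs ys} →
                  Pointwise (λ f y → (λ _ → p) ⊢ f [ xs ]⇓ y) fs ys →
                  compile* fs runs encode xs ⇒ encode ys
  -- Induction on the derivation peels off the last round first, so the statement is in continuation
  -- form: `x` of the `x + c` rounds are done, and the hypothesis covers the other `c`.
  recursion-runs : ∀ {f : Rec 1 n} {g xs x y w} →
    (λ _ → p) ⊢ prec f g [ x ∷ xs ]⇓ y → ∀ c →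
    While (recursionStep (compile g)) runs pair c (pair x (pair y (encode xs))) ⇒ w →
    recursion (compile f) (compile g) runs pair (x + c) (encode xs) ⇒ w
  prec-runs : ∀ {f : Rec 1 n} {g xs x y} → (λ _ → p) ⊢ prec f g [ x ∷ xs ]⇓ y →
              compile (prec f g) runs encode (x ∷ xs) ⇒ y
  -- The existential stays packed for termination, as in `0≢suc`.
  compile-runs-suc : ∀ {f : Rec 1 n} {xs} → ∃[ z ] (λ _ → p) ⊢ f [ xs ]⇓ suc z →
                     ∃[ z ] compile f runs encode xs ⇒ suc z
  -- Induction on the distance `i` from the current argument `j` to the zero `y`; `v` is the value
  -- at `j`, which the loop carries as its counter.
  search-runs : ∀ {f : Rec 1 (suc n)} {xs y} →
    (∀ x → x < y → ∃[ z ] (λ _ → p) ⊢ f [ x ∷ xs ]⇓ suc z) →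
    (λ _ → p) ⊢ f [ y ∷ xs ]⇓ 0 → ∀ i j → i + j ≡ y →
    ∃[ v ] compile f runs encode (j ∷ xs) ⇒ v ×
           While (searchStep (compile f)) runs pair v (encode (j ∷ xs)) ⇒ encode (y ∷ xs)

  compile-runs zero           = runs-Zero p P₀
  compile-runs suc            = runs-Seq p P₀ (runs-Fst p P₀) (runs-Suc p P₀)
  compile-runs (proj {i = i} {xs}) = projection-runs i xs
  compile-runs oracle         = runs-Seq p P₀ (runs-Fst p P₀) (runs-Query p P₀)
  compile-runs (comp ds d)    = runs-Seq p P₀ (compile*-runs ds) (compile-runs d)
  compile-runs d@(prec-zero _)  = prec-runs d
  compile-runs d@(prec-suc _ _) = prec-runs d
  compile-runs (min {y = y} h d) =
    let v , test , search = search-runs h d y 0 (+-identityʳ y) in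
    runs-Seq p P₀ (runs-Fork p P₀ (runs-Zero p P₀) (runs-Id p P₀))
    (runs-Seq p P₀ (runs-Fork p P₀ test (runs-Id p P₀))
    (runs-Seq p P₀ search (runs-Fst p P₀)))

  compile*-runs []       = runs-Zero p P₀
  compile*-runs (d ∷ ds) = runs-Fork p P₀ (compile-runs d) (compile*-runs ds)

  recursion-runs (prec-zero d) c loop = runs-Seq p P₀
    (runs-Fork p P₀ (runs-Fst p P₀)
    (runs-Fork p P₀ (runs-Zero p P₀)
    (runs-Fork p P₀ (runs-Seq p P₀ (runs-Snd p P₀) (compile-runs d)) (runs-Snd p P₀))))
    loop
  recursion-runs {f = f} {g} {xs} {suc x} {w = w} (prec-suc d d′) c loop =
    subst (λ m → recursion (compile f) (compile g) runs pair m (encode xs) ⇒ w) (+-suc x c)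
      (recursion-runs d (suc c)
        (runs-While-suc p P₀
          (runs-Fork p P₀ (runs-Fst p P₀)
          (runs-Seq p P₀ (runs-Snd p P₀)
          (runs-Fork p P₀ (runs-Seq p P₀ (runs-Fst p P₀) (runs-Suc p P₀))
          (runs-Fork p P₀ (compile-runs d′)
                          (runs-Seq p P₀ (runs-Snd p P₀) (runs-Snd p P₀))))))
          loop))

  prec-runs {f = f} {g} {xs} {x} {y} d = runs-Seq p P₀
    (subst (λ m → recursion (compile f) (compile g) runs pair m (encode xs)
                  ⇒ pair x (pair y (encode xs))) (+-identityʳ x)
           (recursion-runs d 0 (runs-While-zero p P₀)))
    (runs-Seq p P₀ (runs-Snd p P₀) (runs-Fst p P₀))

  compile-runs-suc (z , d) = z , compile-runs d

  search-runs h d zero j refl = 0 , compile-runs d , runs-While-zero p P₀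
  search-runs h d (suc i) j refl =
    let z , rf = compile-runs-suc (h j (s≤s (m≤n+m j i)))
        v , test , search = search-runs h d i (suc j) (+-suc i j)
    in suc z , rf , runs-While-suc p P₀
      (runs-Seq p P₀ (runs-Snd p P₀)
      (runs-Seq p P₀
        (runs-Fork p P₀ (runs-Seq p P₀ (runs-Fst p P₀) (runs-Suc p P₀)) (runs-Snd p P₀))
        (runs-Fork p P₀ test (runs-Id p P₀))))
      search

compile-halts : ∀ {p} {f : Rec 1 1} {y} → (λ _ → p) ⊢ f [ 0 ∷ [] ]⇓ y →
                ∃[ t ] running (run p (compile f) t) ≡ 0 ×
                       snd (run p (compile f) t) ≡ y
compile-halts {p} {f} {y} d =
  let t , eq = compile-runs p (compile f) d (pair Halt 0) 0 refl
  in t , trans (cong running eq) halted , trans (cong snd eq) (snd-pair _ y)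
  where
  halted : running (pair (pair Halt 0) y) ≡ 0
  halted rewrite fst-pair (pair Halt 0) y | fst-pair Halt 0 = fst-pair 0 0

-- The relation

-- The number pair e m has tag e, and its kind is the parity of m.  Listing
-- the numbers of kind i with tag e gives the oracle for the code e.

name : ℕ → ℕ → Baire
name e i n = pair e (i + (n + n))

-- The code `e` is run on a name whose entries all carry the tag `e`; this is the self-reference
-- behind the diagonal argument.
state : ℕ → ℕ → ℕ → ℕ
state e i = run (name e i) e

-- The oracle `name e i` is itself arithmetic in `e` and `i`, so queries are computed inline and the
-- whole run is primitive recursive.
`state : Term n → Term n → Term n → Term n
`state t₁ t₂ t₃ = app state-term (t₃ ∷ t₁ ∷ t₂ ∷ [])
  where
  execute-term : Term 7
  execute-term = `switch op
    ( `pair (`pair (`pair op arg) K) v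
    ∷ `pair K v
    ∷ `pair K (lit 0)
    ∷ `pair K (`suc v)
    ∷ `pair K (`fst v)
    ∷ `pair K (`snd v)
    ∷ (`ifz `suc v `∸ s then `pair K (`pair e (i `+ (v `+ v)))
       else `pair (`pair (`pair op arg) K) v)
    ∷ `pair (`pair (`fst arg) (`pair (`snd arg) K)) v
    ∷ `pair (`pair (`fst arg)
        (`pair (`pair (lit 10) (`pair v (`snd arg))) K)) v
    ∷ (`ifz `fst v then `pair K (`snd v)
       else `pair (`pair arg (`pair (`pair (lit 9) arg) K))
                  (`pair (`pred (`fst v)) (`snd v)))
    ∷ `pair (`pair (`snd arg) (`pair (`pair (lit 11) v) K)) (`fst arg)
    ∷ `pair K (`pair arg v)
    ∷ [])
    where
    s op arg K v e i : Term 7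
    s   = var (# 0)
    op  = var (# 1)
    arg = var (# 2)
    K   = var (# 3)
    v   = var (# 4)
    e   = var (# 5)
    i   = var (# 6)

  run-term : Term 3
  run-term = primrecTerm
    (`pair (`pair (var (# 0)) (`pair (lit Halt) (lit 0))) (`pair (lit 0) (lit 0)))
    (app execute-term
      ( var (# 0) ∷ `fst (`fst (`fst c)) ∷ `snd (`fst (`fst c)) ∷ `snd (`fst c)
      ∷ `snd c ∷ var (# 2) ∷ var (# 3) ∷ []))
    where
    c : Term 4
    c = var (# 1)

  correct : ∀ t e i → ⟦ run-term ⟧ (t ∷ e ∷ i ∷ []) ≡ state e i t
  correct zero    e i = refl
  correct (suc t) e i = cong (step (name e i) t) (correct t e i)

  state-term : Term 3
  state-term = record
    { program  = program run-term
    ; ⟦_⟧      = λ xs → state (lookup xs (# 1)) (lookup xs (# 2)) (lookup xs (# 0))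
    ; computes = λ { xs@(t ∷ e ∷ i ∷ []) →
        subst (_ ⊢ program run-term [ xs ]⇓_) (correct t e i) (computes run-term xs) }
    }

-- A record rather than a bare equation, so that `e`, `i` and `t` can be inferred from a proof.
record Halted (e i t : ℕ) : Set where
  constructor halted
  field running≡0 : running (state e i t) ≡ 0

open Halted

Merged : ℕ → ℕ → Set
Merged e t = Halted e 0 t × Halted e 1 t × snd (state e 0 t) ≢ snd (state e 1 t)

-- Ideals have valid elements at arbitrarily late stages, so this governs which chains generate
-- points. Kind 0 is suspended while the first run has halted and the second has not; kind 1 starts
-- when the first has halted.
Valid : (e kind t : ℕ) → Set
Valid e zero    t = Halted e 0 t → Halted e 1 t
Valid e (suc _) t = Halted e 0 t

kind : ℕ → ℕ
kind x = parity (snd x)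

Close : (x y t : ℕ) → Set
Close x y t = kind x ≡ kind y ⊎ Merged (fst y) t

infix 4 _≪_

-- The second component of the upper element is the stage at which halting is tested, which keeps
-- the relation decidable. Strictness forces every ideal to reach arbitrarily late stages.
_≪_ : Rel ℕ 0ℓ
x ≪ y = fst x ≡ fst y × snd x < snd y ×
        Valid (fst y) (kind y) (snd y) × Close x y (snd y)

Halted-mono : ∀ {e i s t} → s ≤ t → Halted e i s → Halted e i t
Halted-mono {e} {i} {s} {t} s≤t (halted h) =
  halted (trans (cong running (run-halted (name e i) e {s} {t} s≤t h)) h)

Halted-unique : ∀ {e i s t} → Halted e i s → Halted e i t →
                snd (state e i s) ≡ snd (state e i t)
Halted-unique {e} {i} {s} {t} (halted hs) (halted ht) =
  cong snd (run-halted-unique (name e i) e {s} {t} hs ht)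

Merged-mono : ∀ {e f s t} → e ≡ f → s ≤ t → Merged e s → Merged f t
Merged-mono refl s≤t (h₀ , h₁ , v₀≢v₁) =
  Halted-mono s≤t h₀ , Halted-mono s≤t h₁ , λ v₀≡v₁ → v₀≢v₁
    (trans (Halted-unique h₀ (Halted-mono s≤t h₀))
    (trans v₀≡v₁ (Halted-unique (Halted-mono s≤t h₁) h₁)))

Agreed : ℕ → ℕ → Set
Agreed e t = Halted e 0 t × Halted e 1 t × snd (state e 0 t) ≡ snd (state e 1 t)

Agreed⇒¬Merged : ∀ {e s t} → Agreed e s → ¬ Merged e t
Agreed⇒¬Merged (h₀ , h₁ , v₀≡v₁) (h₀′ , h₁′ , v₀≢v₁) = v₀≢v₁
  (trans (Halted-unique h₀′ h₀) (trans v₀≡v₁ (Halted-unique h₁ h₁′)))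

-- Validity concerns the upper element only, and merging persists to later stages.
≪-trans : Transitive _≪_
≪-trans {x} {y} {z} (xy , x<y , _ , near) (yz , y<z , valid , near′) =
  trans xy yz , <-trans x<y y<z , valid , kinds near near′
  where
  kinds : Close x y (snd y) → Close y z (snd z) → Close x z (snd z)
  kinds (inj₁ eq) (inj₁ eq′) = inj₁ (trans eq eq′)
  kinds (inj₁ eq) (inj₂ mgd) = inj₂ mgd
  kinds (inj₂ mgd) _          = inj₂ (Merged-mono yz (<⇒≤ y<z) mgd)

-- Tests hold when they are zero.

`Running : Term n → Term n → Term n → Term n
`Running e i t = `fst (`fst (`fst (`state e i t)))

`value : Term n → Term n → Term n → Term n
`value e i t = `snd (`state e i t)

`not : Term n → Term n
`not t = `ifz t then lit 1 else lit 0

not-zero⁺ : ∀ {b} → b ≢ 0 → ifz b then 1 else 0 ≡ 0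
not-zero⁺ {zero}  b≢0 = contradiction refl b≢0
not-zero⁺ {suc b} b≢0 = refl

not-zero⁻ : ∀ {b} → ifz b then 1 else 0 ≡ 0 → b ≢ 0
not-zero⁻ {suc b} _ ()

not-nonzero⁺ : ∀ {b} → b ≡ 0 → ifz b then 1 else 0 ≢ 0
not-nonzero⁺ refl ()

not-nonzero⁻ : ∀ {b} → ifz b then 1 else 0 ≢ 0 → b ≡ 0
not-nonzero⁻ {zero}  _    = refl
not-nonzero⁻ {suc b} 0≢0 = contradiction refl 0≢0

-- With zero as truth, sums are conjunctions and products are disjunctions.
`Merged : Term n → Term n → Term n
`Merged e t = `Running e (lit 0) t `+ (`Running e (lit 1) t `+
  `not `∣ `value e (lit 0) t - `value e (lit 1) t ∣)

`Agreed : Term n → Term n → Term n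
`Agreed e t = `Running e (lit 0) t `+ (`Running e (lit 1) t `+
  `∣ `value e (lit 0) t - `value e (lit 1) t ∣)

`Valid : Term n → Term n → Term n → Term n
`Valid e i t = `ifz i
  then (`ifz `Running e (lit 0) t then `Running e (lit 1) t else lit 0)
  else `Running e (lit 0) t

`Close : Term n → Term n → Term n → Term n
`Close x y t =
  `∣ `parity (`snd x) - `parity (`snd y) ∣ `* `Merged (`fst y) t

`≪ : Term n → Term n → Term n
`≪ x y =
  `∣ `fst x - `fst y ∣ `+ ((`suc (`snd x) `∸ `snd y) `+
  (`Valid (`fst y) (`parity (`snd y)) (`snd y) `+ `Close x y (`snd y)))

a≡0∧b≡0⇒a+b≡0 : ∀ {a b} → a ≡ 0 → b ≡ 0 → a + b ≡ 0
a≡0∧b≡0⇒a+b≡0 refl refl = refl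

a≡0∨b≡0⇒a*b≡0 : ∀ {a b} → a ≡ 0 ⊎ b ≡ 0 → a * b ≡ 0
a≡0∨b≡0⇒a*b≡0     (inj₁ refl) = refl
a≡0∨b≡0⇒a*b≡0 {a} (inj₂ refl) = *-zeroʳ a

module _ (e t : Term n) (xs : Vec ℕ n) where
  private
    r₀ = running (state (⟦ e ⟧ xs) 0 (⟦ t ⟧ xs))
    r₁ = running (state (⟦ e ⟧ xs) 1 (⟦ t ⟧ xs))

  Merged⁻ : ⟦ `Merged e t ⟧ xs ≡ 0 → Merged (⟦ e ⟧ xs) (⟦ t ⟧ xs)
  Merged⁻ eq =
    halted (m+n≡0⇒m≡0 r₀ eq) ,
    halted (m+n≡0⇒m≡0 r₁ (m+n≡0⇒n≡0 r₀ eq)) ,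
    not-zero⁻ (m+n≡0⇒n≡0 r₁ (m+n≡0⇒n≡0 r₀ eq)) ∘ m≡n⇒∣m-n∣≡0

  Merged⁺ : Merged (⟦ e ⟧ xs) (⟦ t ⟧ xs) → ⟦ `Merged e t ⟧ xs ≡ 0
  Merged⁺ (halted h₀ , halted h₁ , v₀≢v₁) =
    a≡0∧b≡0⇒a+b≡0 h₀ (a≡0∧b≡0⇒a+b≡0 h₁ (not-zero⁺ (v₀≢v₁ ∘ ∣m-n∣≡0⇒m≡n)))

  Agreed⁻ : ⟦ `Agreed e t ⟧ xs ≡ 0 → Agreed (⟦ e ⟧ xs) (⟦ t ⟧ xs)
  Agreed⁻ eq =
    halted (m+n≡0⇒m≡0 r₀ eq) ,
    halted (m+n≡0⇒m≡0 r₁ (m+n≡0⇒n≡0 r₀ eq)) ,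
    ∣m-n∣≡0⇒m≡n (m+n≡0⇒n≡0 r₁ (m+n≡0⇒n≡0 r₀ eq))

  Agreed⁺ : Agreed (⟦ e ⟧ xs) (⟦ t ⟧ xs) → ⟦ `Agreed e t ⟧ xs ≡ 0
  Agreed⁺ (halted h₀ , halted h₁ , v₀≡v₁) =
    a≡0∧b≡0⇒a+b≡0 h₀ (a≡0∧b≡0⇒a+b≡0 h₁ (m≡n⇒∣m-n∣≡0 v₀≡v₁))

  Valid⁻ : ∀ i → ⟦ `Valid e i t ⟧ xs ≡ 0 → Valid (⟦ e ⟧ xs) (⟦ i ⟧ xs) (⟦ t ⟧ xs)
  Valid⁻ i eq with ⟦ i ⟧ xs
  ... | suc _ = halted eq
  ... | zero with r₀ in eq₀
  ...   | zero  = λ _ → halted eq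
  ...   | suc _ = λ (halted h₀) → contradiction (trans (sym h₀) eq₀) 0≢1+n

  Valid⁺ : ∀ i → Valid (⟦ e ⟧ xs) (⟦ i ⟧ xs) (⟦ t ⟧ xs) → ⟦ `Valid e i t ⟧ xs ≡ 0
  Valid⁺ i v with ⟦ i ⟧ xs
  ... | suc _ = running≡0 v
  ... | zero with r₀ in eq₀
  ...   | zero  = running≡0 (v (halted eq₀))
  ...   | suc _ = refl

module _ (x y t : Term n) (xs : Vec ℕ n) where

  Close⁻ : ⟦ `Close x y t ⟧ xs ≡ 0 → Close (⟦ x ⟧ xs) (⟦ y ⟧ xs) (⟦ t ⟧ xs)
  Close⁻ eq with m*n≡0⇒m≡0∨n≡0 ∣ kind (⟦ x ⟧ xs) - kind (⟦ y ⟧ xs) ∣ eq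
  ... | inj₁ eq′ = inj₁ (∣m-n∣≡0⇒m≡n eq′)
  ... | inj₂ eq′ = inj₂ (Merged⁻ (`fst y) t xs eq′)

  Close⁺ : Close (⟦ x ⟧ xs) (⟦ y ⟧ xs) (⟦ t ⟧ xs) → ⟦ `Close x y t ⟧ xs ≡ 0
  Close⁺ (inj₁ eq)  = a≡0∨b≡0⇒a*b≡0 (inj₁ (m≡n⇒∣m-n∣≡0 eq))
  Close⁺ (inj₂ mgd) = a≡0∨b≡0⇒a*b≡0 {∣ kind (⟦ x ⟧ xs) - kind (⟦ y ⟧ xs) ∣}
                             (inj₂ (Merged⁺ (`fst y) t xs mgd))

≪⁻ : ∀ (x y : Term n) xs → ⟦ `≪ x y ⟧ xs ≡ 0 → ⟦ x ⟧ xs ≪ ⟦ y ⟧ xs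
≪⁻ x y xs eq =
  ∣m-n∣≡0⇒m≡n (m+n≡0⇒m≡0 a eq) ,
  m∸n≡0⇒m≤n (m+n≡0⇒m≡0 b (m+n≡0⇒n≡0 a eq)) ,
  Valid⁻ (`fst y) (`snd y) xs (`parity (`snd y))
    (m+n≡0⇒m≡0 c (m+n≡0⇒n≡0 b (m+n≡0⇒n≡0 a eq))) ,
  Close⁻ x y (`snd y) xs (m+n≡0⇒n≡0 c (m+n≡0⇒n≡0 b (m+n≡0⇒n≡0 a eq)))
  where
  a = ∣ fst (⟦ x ⟧ xs) - fst (⟦ y ⟧ xs) ∣
  b = suc (snd (⟦ x ⟧ xs)) ∸ snd (⟦ y ⟧ xs)
  c = ⟦ `Valid (`fst y) (`parity (`snd y)) (`snd y) ⟧ xs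

≪⁺ : ∀ (x y : Term n) xs → ⟦ x ⟧ xs ≪ ⟦ y ⟧ xs → ⟦ `≪ x y ⟧ xs ≡ 0
≪⁺ x y xs (tags , x<y , valid , close) =
  a≡0∧b≡0⇒a+b≡0 (m≡n⇒∣m-n∣≡0 tags)
  (a≡0∧b≡0⇒a+b≡0 (m≤n⇒m∸n≡0 x<y)
  (a≡0∧b≡0⇒a+b≡0 (Valid⁺ (`fst y) (`snd y) xs (`parity (`snd y)) valid)
          (Close⁺ x y (`snd y) xs close)))

-- The value of `test` does not depend on the variable searched, so `min` stops, at once, exactly
-- when the relation holds.
≪-computablyEnumerable : ComputablyEnumerable _≪_
≪-computablyEnumerable = min (program test) , λ x y → mk⇔
  (λ x≪y → 0 , min (λ _ ()) (subst (noOracle ⊢ program test [ 0 ∷ x ∷ y ∷ [] ]⇓_)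
                                   (≪⁺ (var (# 1)) (var (# 2)) (0 ∷ x ∷ y ∷ []) x≪y)
                                   (computes test (0 ∷ x ∷ y ∷ []))))
  (λ { (z , min _ d) → ≪⁻ (var (# 1)) (var (# 2)) (z ∷ x ∷ y ∷ [])
                          (⇓-deterministic (computes test _) d) })
  where
  test : Term 3
  test = `≪ (var (# 1)) (var (# 2))

-- Ideals

module _ {I : Pred ℕ 0ℓ} (I-ideal : IsIdeal _≪_ I) where
  open IsIdeal I-ideal

  -- Directedness applied to `x` and `x` gives an element strictly above `x`; iterating passes every
  -- stage.
  climb : ∀ {x} → x ∈ I → ∀ t → ∃[ y ] y ∈ I × x ≪ y × t < snd y
  climb x∈I zero with y , y∈I , x≪y@(_ , x<y , _) , _ ← directed x∈I x∈I =
    y , y∈I , x≪y , ≤-<-trans z≤n x<y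
  climb {x} x∈I (suc t)
    with y , y∈I , x≪y , t<y ← climb x∈I t
    with z , z∈I , y≪z@(_ , y<z , _) , _ ← directed y∈I y∈I =
    z , z∈I , ≪-trans {x} {y} {z} x≪y y≪z , ≤-<-trans t<y y<z

-- Both refer to one element of each ideal and search for a stage of a decidable condition, hence
-- are semidecidable from names.
Indistinct Distinct : ℕ → ℕ → Set
Indistinct x y = fst x ≡ fst y × ∃[ t ] Close x y t
Distinct   x y = fst x ≢ fst y ⊎ kind x ≢ kind y × ∃[ t ] Agreed (fst y) t

Indistinct-sym : ∀ {x y} → Indistinct x y → Indistinct y x
Indistinct-sym (tags , t , inj₁ eq)  = sym tags , t , inj₁ (sym eq)
Indistinct-sym (tags , t , inj₂ mgd) =
  sym tags , t , inj₂ (Merged-mono (sym tags) ≤-refl mgd)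

Distinct⇒¬Indistinct : ∀ {x y} → Distinct x y → ¬ Indistinct x y
Distinct⇒¬Indistinct (inj₁ tags≢)          (tags , _)          = tags≢ tags
Distinct⇒¬Indistinct (inj₂ (kinds≢ , _))   (_ , _ , inj₁ kinds) = kinds≢ kinds
Distinct⇒¬Indistinct (inj₂ (_ , _ , agreed)) (_ , _ , inj₂ mgd) =
  Agreed⇒¬Merged agreed mgd

module _ {I J : Pred ℕ 0ℓ} (I-ideal : IsIdeal _≪_ I) (J-ideal : IsIdeal _≪_ J)
         {x y} (x∈I : x ∈ I) (y∈J : y ∈ J) where
  private
    module I = IsIdeal I-ideal
    module J = IsIdeal J-ideal

  -- Let `z` bound `w` and `x` in `I`, and let `y′` in `J` lie above `y`, later than `z` and `t`.
  -- Closeness passes along `w`, `z`, `x`, `y`, `y′`, and any merging met on the way persists to the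
  -- stage of `y′`.
  Indistinct⇒⊆ : Indistinct x y → I ⊆ J
  Indistinct⇒⊆ (tags , t , close) {w} w∈I
    with z , _ , (wz , w<z , _ , close-wz) , (xz , _ , _ , close-xz) ← I.directed w∈I x∈I
    with y′ , y′∈J , (yy′ , _ , valid , close-yy′) , z⊔t<y′ ← climb J-ideal y∈J (snd z ⊔ t)
    = J.lower (trans wz (trans (sym xz) (trans tags yy′)) , <-trans w<z z<y′ , valid ,
               kinds close-wz close-xz close close-yy′) y′∈J
    where
    z<y′ : snd z < snd y′
    z<y′ = ≤-<-trans (m≤m⊔n (snd z) t) z⊔t<y′

    zy′ : fst z ≡ fst y′
    zy′ = trans (sym xz) (trans tags yy′)

    kinds : Close w z (snd z) → Close x z (snd z) → Close x y t →
            Close y y′ (snd y′) → Close w y′ (snd y′)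
    kinds (inj₂ mgd) _          _          _          = inj₂ (Merged-mono zy′ (<⇒≤ z<y′) mgd)
    kinds _          (inj₂ mgd) _          _          = inj₂ (Merged-mono zy′ (<⇒≤ z<y′) mgd)
    kinds _          _          (inj₂ mgd) _          =
      inj₂ (Merged-mono yy′ (<⇒≤ (≤-<-trans (m≤n⊔m (snd z) t) z⊔t<y′)) mgd)
    kinds _          _          _          (inj₂ mgd) = inj₂ mgd
    kinds (inj₁ a)   (inj₁ b)   (inj₁ c)   (inj₁ d)   =
      inj₁ (trans a (trans (sym b) (trans c d)))

  -- Both elements lie in `I`, so closeness passes through a common upper bound, whose stage is the
  -- witness.
  ≐⇒Indistinct : I ≐ J → Indistinct x y
  ≐⇒Indistinct (_ , J⊆I)
    with z , _ , (xz , _ , _ , close) , (yz , _ , _ , close′) ← I.directed x∈I (J⊆I y∈J)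
    = trans xz (sym yz) , snd z , kinds close close′
    where
    kinds : Close x z (snd z) → Close y z (snd z) → Close x y (snd z)
    kinds (inj₁ a)   (inj₁ b)   = inj₁ (trans a (sym b))
    kinds (inj₂ mgd) _          = inj₂ (Merged-mono (sym yz) ≤-refl mgd)
    kinds _          (inj₂ mgd) = inj₂ (Merged-mono (sym yz) ≤-refl mgd)

  -- A point of kind 1 witnesses that the first run has halted, and then a
  -- point of kind 0 witnesses that the second one has.
  both-halt : fst x ≡ fst y → kind x ≡ 0 → kind y ≡ 1 →
              ∃[ t ] Halted (fst y) 0 t × Halted (fst y) 1 t
  both-halt xy kx ky
    with y′ , _ , (yy′ , _ , valid , close) , _ ← climb J-ideal y∈J 0
    -- At a stage beyond that of `y′` the halting of the first run is already visible and discharges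
    -- the premise in the validity of kind 0.
    with x′ , _ , (xx′ , _ , valid′ , close′) , y′<x′ ← climb I-ideal x∈I (snd y′)
    = halts close close′
    where
    halts : Close y y′ (snd y′) → Close x x′ (snd x′) →
            ∃[ t ] Halted (fst y) 0 t × Halted (fst y) 1 t
    halts (inj₂ (h₀ , h₁ , _)) _ rewrite yy′ = snd y′ , h₀ , h₁
    halts _ (inj₂ (h₀ , h₁ , _)) rewrite trans (sym xy) xx′ = snd x′ , h₀ , h₁
    halts (inj₁ kyy′) (inj₁ kxx′) = snd x′ , h₀ ,
      subst (λ k → Valid (fst y) k (snd x′)) (trans (sym kxx′) kx)
        (subst (λ e → Valid e (kind x′) (snd x′)) (trans (sym xx′) xy) valid′) h₀
      where
      h₀ : Halted (fst y) 0 (snd x′)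
      h₀ = Halted-mono (<⇒≤ y′<x′)
        (subst (λ k → Valid (fst y) k (snd y′)) (trans (sym kyy′) ky)
          (subst (λ e → Valid e (kind y′) (snd y′)) (sym yy′) valid))

module _ {I J : Pred ℕ 0ℓ} (I-ideal : IsIdeal _≪_ I) (J-ideal : IsIdeal _≪_ J)
         {x y} (x∈I : x ∈ I) (y∈J : y ∈ J) where

  Indistinct⇒≐ : Indistinct x y → I ≐ J
  Indistinct⇒≐ ind = Indistinct⇒⊆ I-ideal J-ideal x∈I y∈J ind ,
    Indistinct⇒⊆ J-ideal I-ideal y∈J x∈I (Indistinct-sym {x} {y} ind)

  -- No halting question has to be decided: if the kinds differ under one tag, the ideals themselves
  -- show that both runs halt, and comparing two numbers remains.
  indistinct-or-distinct : Indistinct x y ⊎ Distinct x y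
  indistinct-or-distinct with fst x ≟ fst y
  ... | no  tags≢ = inj₂ (inj₁ tags≢)
  ... | yes tags with kind x ≟ kind y
  ...   | yes kinds = inj₁ (tags , 0 , inj₁ kinds)
  ...   | no kinds≢ = compare halts
    where
    halts : ∃[ t ] Halted (fst y) 0 t × Halted (fst y) 1 t
    halts with parity-binary (snd x) | parity-binary (snd y)
    ... | inj₁ kx | inj₁ ky = contradiction (trans kx (sym ky)) kinds≢
    ... | inj₂ kx | inj₂ ky = contradiction (trans kx (sym ky)) kinds≢
    ... | inj₁ kx | inj₂ ky = both-halt I-ideal J-ideal x∈I y∈J tags kx ky
    ... | inj₂ kx | inj₁ ky with t , h ← both-halt J-ideal I-ideal y∈J x∈I (sym tags) ky kx
      = t , subst (λ e → Halted e 0 t × Halted e 1 t) tags h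

    compare : ∃[ t ] Halted (fst y) 0 t × Halted (fst y) 1 t → Indistinct x y ⊎ Distinct x y
    compare (t , h₀ , h₁) with snd (state (fst y) 0 t) ≟ snd (state (fst y) 1 t)
    ... | yes eq = inj₂ (inj₂ (kinds≢ , t , h₀ , h₁ , eq))
    ... | no neq = inj₁ (tags , t , inj₂ (h₀ , h₁ , neq))

-- The space

X : RepresentedSpace (lsuc 0ℓ) 0ℓ
X = Ideals _≪_

open RepresentedSpace X using (Carrier; _⊩_)

first∈ : ∀ {p} (a : Carrier) → p ⊩ a → p 0 ∈ proj₁ a
first∈ _ (_ , range⊆I) = range⊆I (0 , refl)

-- By Indistinct⇒≐, the first entries of two names suffice to compare the
-- points they name.
module _ (U : Pred (Carrier × Carrier) 0ℓ) (U? : ∀ z → Dec (z ∈ U)) (test : Term 3)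
         (test-correct : ∀ a b {x y} → x ∈ proj₁ a → y ∈ proj₁ b →
                         (a , b) ∈ U ⇔ (∃[ t ] ⟦ test ⟧ (t ∷ x ∷ y ∷ []) ≢ 0))
         where

  test⇒open : ComputablyOpen (X ⊗ X) U
  test⇒open = χ , (λ z → does⇔ (U? z)) , M , realises
    where
    module T a b {x} {y} x∈a y∈b = Equivalence (test-correct a b {x} {y} x∈a y∈b)

    U-resp : ∀ {a b a′ b′} → proj₁ a ≐ proj₁ a′ → proj₁ b ≐ proj₁ b′ →
             (a , b) ∈ U → (a′ , b′) ∈ U
    U-resp {a@(_ , _ , _ , a-named)} {b@(_ , _ , _ , b-named)} {a′} {b′}
           (a⊆a′ , _) (b⊆b′ , _) u =
      -- `x` and `y` also lie in `a′` and `b′`, and the test sees nothing else of the points.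
      T.from a′ b′ (a⊆a′ x∈a) (b⊆b′ y∈b) (T.to a b x∈a y∈b u)
      where
      x∈a = first∈ a a-named
      y∈b = first∈ b b-named

    χ : Func (RepresentedSpace.setoid (X ⊗ X)) (RepresentedSpace.setoid Sierpinski)
    χ = record
      { to   = λ z → does (U? z)
      ; cong = λ { {z@(a , b)} {z′@(a′ , b′)} (a≐a′ , b≐b′) → does-⇔
          (mk⇔ (U-resp {a} {b} {a′} {b′} a≐a′ b≐b′)
               (U-resp {a′} {b′} {a} {b} (≐-sym a≐a′) (≐-sym b≐b′)))
          (U? z) (U? z′) }
      }

    does⇔ : ∀ {z} (u? : Dec (z ∈ U)) → does u? ≡ true ⇔ z ∈ U
    does⇔ (yes u) = mk⇔ (λ _ → u) (λ _ → refl)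
    does⇔ (no ¬u) = mk⇔ (λ ()) (λ u → contradiction u ¬u)

    M : Rec 1 1
    -- Entries 0 and 1 of a name of a pair are the first entries of the names of its components; the
    -- argument of `M` is the stage.
    M = comp (program test)
      (proj zero ∷ comp (oracle zero) (numeral 0 ∷ []) ∷
       comp (oracle zero) (numeral 1 ∷ []) ∷ [])

    realises : Realises (X ⊗ X) Sierpinski (graph M) (Func.to χ)
    realises z@(a , b) p (p⊩a , p⊩b) =
      q , (λ n → comp (proj ∷ comp (numeral-⇓ 0 ∷ []) oracle
                            ∷ comp (numeral-⇓ 1 ∷ []) oracle ∷ [])
                      (computes test (n ∷ p 0 ∷ p 1 ∷ [])))
        , names (U? z)
      where
      q : Baire
      q n = ⟦ test ⟧ (n ∷ p 0 ∷ p 1 ∷ [])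

      open T a b (first∈ a p⊩a) (first∈ b p⊩b)

      names : (u? : Dec (z ∈ U)) → q NamesInSierpinski does u?
      names (yes u) = let t , qt≢0 = to u in ⊤-name t qt≢0
      names (no ¬u) = ⊥-name (λ n → decidable-stable (q n ≟ 0) (λ qn≢0 → ¬u (from (n , qn≢0))))

_≐?_ : ∀ (a b : Carrier) → Dec (proj₁ a ≐ proj₁ b)
a@(_ , I-ideal , _ , a-named) ≐? b@(_ , J-ideal , _ , b-named)
  with indistinct-or-distinct I-ideal J-ideal (first∈ a a-named) (first∈ b b-named)
... | inj₁ ind = yes (Indistinct⇒≐ I-ideal J-ideal (first∈ a a-named) (first∈ b b-named) ind)
... | inj₂ dis = no
  (Distinct⇒¬Indistinct dis ∘
   ≐⇒Indistinct I-ideal J-ideal (first∈ a a-named) (first∈ b b-named))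

`tags : Term 3
`tags = `∣ `fst (var (# 1)) - `fst (var (# 2)) ∣

-- Naming ⊤ takes a non-zero value while tests hold at zero, hence the `not`.
X-discrete : ComputablyDiscrete X
X-discrete = test⇒open (Diagonal X) (λ (a , b) → a ≐? b) (`not (`tags `+ close)) λ
  (I , I-ideal , _) (J , J-ideal , _) {x} {y} x∈I y∈J → mk⇔
    (λ I≐J → let tags , t , c = ≐⇒Indistinct I-ideal J-ideal x∈I y∈J I≐J in
      t , not-nonzero⁺ (a≡0∧b≡0⇒a+b≡0 (m≡n⇒∣m-n∣≡0 tags)
            (Close⁺ (var (# 1)) (var (# 2)) (var (# 0)) (t ∷ x ∷ y ∷ []) c)))
    (λ (t , test≢0) → let eq = not-nonzero⁻ test≢0 in
      Indistinct⇒≐ I-ideal J-ideal x∈I y∈J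
        ( ∣m-n∣≡0⇒m≡n (m+n≡0⇒m≡0 ∣ fst x - fst y ∣ eq) , t
        , Close⁻ (var (# 1)) (var (# 2)) (var (# 0)) (t ∷ x ∷ y ∷ [])
                 (m+n≡0⇒n≡0 ∣ fst x - fst y ∣ eq)))
  where
  close : Term 3
  close = `Close (var (# 1)) (var (# 2)) (var (# 0))

X-Hausdorff : ComputablyHausdorff X
X-Hausdorff = test⇒open (∁ (Diagonal X)) (λ (a , b) → ¬? (a ≐? b)) test λ
  (I , I-ideal , _) (J , J-ideal , _) {x} {y} x∈I y∈J → mk⇔
    (λ I≢J → [ (λ ind → contradiction (Indistinct⇒≐ I-ideal J-ideal x∈I y∈J ind) I≢J)
             , test⁺ ]′ (indistinct-or-distinct I-ideal J-ideal x∈I y∈J))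
    (λ (t , test≢0) I≐J → Distinct⇒¬Indistinct (test⁻ t test≢0)
                            (≐⇒Indistinct I-ideal J-ideal x∈I y∈J I≐J))
  where
  agreed : Term 3
  agreed = `Agreed (`fst (var (# 2))) (var (# 0))

  test : Term 3
  -- Success is now a non-zero value, so the sum is a disjunction and the product a conjunction.
  test = `tags `+
    `∣ `parity (`snd (var (# 1))) - `parity (`snd (var (# 2))) ∣ `* `not agreed

  test⁺ : ∀ {x y} → Distinct x y → ∃[ t ] ⟦ test ⟧ (t ∷ x ∷ y ∷ []) ≢ 0
  test⁺ {x} {y} (inj₁ tags≢) = 0 , tags≢ ∘ ∣m-n∣≡0⇒m≡n ∘ m+n≡0⇒m≡0 ∣ fst x - fst y ∣
  test⁺ {x} {y} (inj₂ (kinds≢ , t , agr)) = t , λ eq →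
    [ kinds≢ ∘ ∣m-n∣≡0⇒m≡n
    , not-nonzero⁺ (Agreed⁺ (`fst (var (# 2))) (var (# 0)) (t ∷ x ∷ y ∷ []) agr) ]′
    (m*n≡0⇒m≡0∨n≡0 ∣ kind x - kind y ∣ (m+n≡0⇒n≡0 ∣ fst x - fst y ∣ eq))

  test⁻ : ∀ {x y} t → ⟦ test ⟧ (t ∷ x ∷ y ∷ []) ≢ 0 → Distinct x y
  test⁻ {x} {y} t test≢0 with fst x ≟ fst y
  ... | no  tags≢ = inj₁ tags≢
  ... | yes tags  = inj₂
    ( (λ kinds → product≢0 (a≡0∨b≡0⇒a*b≡0 (inj₁ (m≡n⇒∣m-n∣≡0 kinds))))
    , t , Agreed⁻ (`fst (var (# 2))) (var (# 0)) (t ∷ x ∷ y ∷ [])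
            (not-nonzero⁻ (product≢0 ∘ a≡0∨b≡0⇒a*b≡0 {∣ kind x - kind y ∣} ∘ inj₂)))
    where
    product≢0 : ∣ kind x - kind y ∣ * ⟦ `not agreed ⟧ (t ∷ x ∷ y ∷ []) ≢ 0
    product≢0 eq = test≢0 (a≡0∧b≡0⇒a+b≡0 (m≡n⇒∣m-n∣≡0 tags) eq)

X-quasiPolish : PrecomputablyQuasiPolish X
X-quasiPolish = _≪_ , (λ {x} {y} {z} → ≪-trans {x} {y} {z}) , ≪-computablyEnumerable ,
  inverse (RepresentedSpace.setoid X) , identity , identity
  where
  identity : Computable X X id
  identity = oracle zero , λ _ p p⊩x → p , (λ _ → oracle) , p⊩x

-- Points of X

≪-pair : ∀ {x e m} → fst x ≡ e → snd x < m → Valid e (parity m) m →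
         kind x ≡ parity m ⊎ Merged e m → x ≪ pair e m
≪-pair {x} {e} {m} tag x<m valid close rewrite fst-pair e m | snd-pair e m =
  tag , x<m , valid , close

parity-name : ∀ {i} → i ≡ 0 ⊎ i ≡ 1 → ∀ n → parity (i + (n + n)) ≡ i
parity-name (inj₁ refl) n = parity-double n
parity-name (inj₂ refl) n = cong (1 ∸_) (parity-double n)

kind-name : ∀ {i} → i ≡ 0 ⊎ i ≡ 1 → ∀ e n → kind (name e i n) ≡ i
kind-name {i} i≡0∨1 e n =
  trans (cong parity (snd-pair e (i + (n + n)))) (parity-name i≡0∨1 n)

module _ {e i} (i≡0∨1 : i ≡ 0 ⊎ i ≡ 1) (unmerged : ∀ t → ¬ Merged e t)
         {N} (valid : ∀ t → N ≤ t → Valid e i t) where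

  kindIdeal : Pred ℕ 0ℓ
  kindIdeal x = fst x ≡ e × kind x ≡ i

  name∈ : ∀ n → name e i n ∈ kindIdeal
  name∈ n = fst-pair e (i + (n + n)) , kind-name i≡0∨1 e n

  -- Without merging, closeness is equality of kinds, which gives lower closure. Two elements are
  -- bounded by a late entry of the chain, valid because its second component is at least `N`.
  kindIdeal-isIdeal : IsIdeal _≪_ kindIdeal
  kindIdeal-isIdeal = record
    { nonempty = name e i 0 , name∈ 0
    ; lower    = λ { {y = y} (xy , _ , _ , inj₁ kxy) (tag , k) → trans xy tag , trans kxy k
                   ; {y = y} (xy , _ , _ , inj₂ mgd) (tag , _) →
                       contradiction (Merged-mono tag ≤-refl mgd) (unmerged (snd y)) }
    ; directed = λ {x} {y} x∈ y∈ →
        let n = N + (suc (snd x) + suc (snd y))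
            x≤n = ≤-trans (m≤m+n (suc (snd x)) (suc (snd y))) (m≤n+m _ N)
            y≤n = ≤-trans (m≤n+m (suc (snd y)) (suc (snd x))) (m≤n+m _ N)
        in name e i n , name∈ n , below n (m≤m+n N _) x∈ x≤n , below n (m≤m+n N _) y∈ y≤n
    }
    where
    below : ∀ {x} n → N ≤ n → x ∈ kindIdeal → snd x < n → x ≪ name e i n
    below n N≤n (tag , k) x<n = ≪-pair tag (<-≤-trans x<n n≤m)
      (subst (λ j → Valid e j (i + (n + n))) (sym (parity-name i≡0∨1 n))
             (valid _ (≤-trans N≤n n≤m)))
      (inj₁ (trans k (sym (parity-name i≡0∨1 n))))
      where
      n≤m : n ≤ i + (n + n)
      n≤m = ≤-trans (m≤m+n n n) (m≤n+m (n + n) i)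

  name-names : kindIdeal ≐ range (name e i)
  name-names =
    -- Halving `snd x` gives the position of `x` in the chain.
    (λ { {x} (refl , refl) → let h , eq = parity-half (snd x) in
           h , trans (cong (pair (fst x)) eq) (pair-fst-snd x) }) ,
    (λ { (n , refl) → name∈ n })

  kindPoint : Carrier
  kindPoint = kindIdeal , kindIdeal-isIdeal , name e i , name-names

splice : ℕ → Baire → Baire → Baire
splice zero    p q n       = q n
splice (suc N) p q zero    = p 0
splice (suc N) p q (suc n) = splice N (p ∘ suc) q n

splice-< : ∀ N p q n → n < N → splice N p q n ≡ p n
splice-< (suc N) p q zero    _         = refl
splice-< (suc N) p q (suc n) (s≤s n<N) = splice-< N (p ∘ suc) q n n<N

splice-+ : ∀ N p q n → splice N p q (N + n) ≡ q n
splice-+ zero    p q n = refl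
splice-+ (suc N) p q n = splice-+ N (p ∘ suc) q n

splice-All : ∀ {P : Pred ℕ 0ℓ} N p q → (∀ n → P (p n)) → (∀ n → P (q n)) →
             ∀ n → P (splice N p q n)
splice-All zero    p q Pp Pq n       = Pq n
splice-All (suc N) p q Pp Pq zero    = Pp 0
splice-All {P} (suc N) p q Pp Pq (suc n) = splice-All {P} N (p ∘ suc) q (Pp ∘ suc) Pq n

module _ {e N} (merged : Merged e N) where

  tagIdeal : Pred ℕ 0ℓ
  tagIdeal x = fst x ≡ e

  -- From stage `N` on both kinds are valid and close to each other, so only tags and stages still
  -- matter.
  tagIdeal-isIdeal : IsIdeal _≪_ tagIdeal
  tagIdeal-isIdeal = record
    { nonempty = pair e 0 , fst-pair e 0
    ; lower    = λ (xy , _) tag → trans xy tag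
    ; directed = λ {x} {y} x∈ y∈ →
        let n = N + (suc (snd x) + suc (snd y))
            x≤n = ≤-trans (m≤m+n (suc (snd x)) (suc (snd y))) (m≤n+m _ N)
            y≤n = ≤-trans (m≤n+m (suc (snd y)) (suc (snd x))) (m≤n+m _ N)
        in pair e n , fst-pair e n , below n (m≤m+n N _) x∈ x≤n , below n (m≤m+n N _) y∈ y≤n
    }
    where
    Merged⇒Valid : ∀ i {t} → Merged e t → Valid e i t
    Merged⇒Valid zero    (_ , h₁ , _) _ = h₁
    Merged⇒Valid (suc _) (h₀ , _)       = h₀

    below : ∀ {x} n → N ≤ n → x ∈ tagIdeal → snd x < n → x ≪ pair e n
    below n N≤n tag x<n = ≪-pair tag x<n (Merged⇒Valid (parity n) mgd) (inj₂ mgd)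
      where
      mgd : Merged e n
      mgd = Merged-mono refl N≤n merged

  -- The tail `pair e` lists every number with tag `e`, so the prefix may come from either chain:
  -- one point gets names that start like both.
  splice-names : ∀ i → tagIdeal ≐ range (splice N (name e i) (pair e))
  splice-names i =
    (λ { {x} refl → N + snd x ,
           trans (splice-+ N (name e i) (pair e) (snd x)) (pair-fst-snd x) }) ,
    (λ { (n , refl) → splice-All {λ x → fst x ≡ e} N (name e i) (pair e)
           (λ n → fst-pair e (i + (n + n))) (fst-pair e) n })

  tagPoint : Carrier
  tagPoint = tagIdeal , tagIdeal-isIdeal , _ , splice-names 0

-- Diagonalisation

no-computableInjection : ¬ ComputableInjection X naturals
no-computableInjection (ι , M , realises) =
  -- Halting is not decidable, but the goal is `⊥`, so its double negation suffices. The maximum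
  -- brings both runs to a common stage.
  first-halts λ (s , h₀) → second-halts h₀ λ (t , h₁) →
    outcome (Halted-mono (m≤m⊔n s t) h₀) (Halted-mono (m≤n⊔m s t) h₁)
  where
  open Injection ι using (to; injective)

  e : ℕ
  e = compile M

  halts : ∀ {p} a → p ⊩ a → ∃[ t ] running (run p e t) ≡ 0 × snd (run p e t) ≡ to a
  halts {p} a p⊩a =
    let q , Mp , q0 = realises a p p⊩a
        t , h , eq  = compile-halts (Mp 0)
    in t , h , trans eq q0

  halted-value : ∀ {p t} a → p ⊩ a → running (run p e t) ≡ 0 →
                 snd (run p e t) ≡ to a
  halted-value {p} {t} a p⊩a h =
    let s , h′ , eq = halts a p⊩a
    in trans (cong snd (run-halted-unique p e {t} {s} h h′)) eq

  -- If the first run never halted, chain 0 would be vacuously valid from stage 0 and never merged;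
  -- it would name a point, on which the realiser halts.
  first-halts : ¬ ¬ (∃[ t ] Halted e 0 t)
  first-halts never =
    let t , h , _ = halts (kindPoint {i = 0} (inj₁ refl) unmerged {0} valid)
                          (name-names (inj₁ refl) unmerged valid)
    in never (t , halted h)
    where
    unmerged : ∀ t → ¬ Merged e t
    unmerged t (h₀ , _) = never (t , h₀)

    valid : ∀ t → 0 ≤ t → Valid e 0 t
    valid t _ h₀ = contradiction (t , h₀) never

  -- From stage `s` on chain 1 is valid; if the second run never halted, there would be no merging
  -- and chain 1 would name a point, on which the realiser halts.
  second-halts : ∀ {s} → Halted e 0 s → ¬ ¬ (∃[ t ] Halted e 1 t)
  second-halts {s} h₀ never =
    let t , h , _ = halts (kindPoint {i = 1} (inj₂ refl) unmerged {s} valid)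
                          (name-names (inj₂ refl) unmerged valid)
    in never (t , halted h)
    where
    unmerged : ∀ t → ¬ Merged e t
    unmerged t (_ , h₁ , _) = never (t , h₁)

    valid : ∀ t → s ≤ t → Valid e 1 t
    valid t s≤t = Halted-mono s≤t h₀

  outcome : ∀ {N} → Halted e 0 N → Halted e 1 N → ⊥
  outcome {N} h₀ h₁ with snd (state e 0 N) ≟ snd (state e 1 N)
  -- Equal values would identify the points of the two chains by injectivity, but the first entry of
  -- chain 0 has kind 0, not 1.
  ... | yes v₀≡v₁ = 0≢1+n (trans (sym (kind-name (inj₁ refl) e 0))
                                 (proj₂ (proj₁ a≐b (name∈ (inj₁ refl) unmerged valid₀ 0))))
    where
    unmerged : ∀ t → ¬ Merged e t
    unmerged t = Agreed⇒¬Merged (h₀ , h₁ , v₀≡v₁)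

    valid₀ : ∀ t → N ≤ t → Valid e 0 t
    valid₀ t N≤t _ = Halted-mono N≤t h₁

    valid₁ : ∀ t → N ≤ t → Valid e 1 t
    valid₁ t N≤t = Halted-mono N≤t h₀

    a b : Carrier
    a = kindPoint {i = 0} (inj₁ refl) unmerged valid₀
    b = kindPoint {i = 1} (inj₂ refl) unmerged valid₁

    a≐b : proj₁ a ≐ proj₁ b
    a≐b = injective {a} {b}
      (trans (sym (halted-value {t = N} a (name-names (inj₁ refl) unmerged valid₀)
                                (running≡0 h₀)))
      (trans v₀≡v₁
        (halted-value {t = N} b (name-names (inj₂ refl) unmerged valid₁)
                      (running≡0 h₁))))
  -- Both runs halt within the first `N` entries, which the two spliced names of the merged point
  -- share with the chains; so both values would be the image of that one point.
  ... | no v₀≢v₁ = v₀≢v₁ (trans (value≡ h₀) (sym (value≡ h₁)))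
    where
    merged : Merged e N
    merged = h₀ , h₁ , v₀≢v₁

    value≡ : ∀ {i} → Halted e i N → snd (state e i N) ≡ to (tagPoint merged)
    value≡ {i} (halted h) = trans (cong snd (sym agree))
      (halted-value {t = N} (tagPoint merged) (splice-names merged i)
                    (trans (cong running agree) h))
      where
      agree : run (splice N (name e i) (pair e)) e N ≡ state e i N
      agree = run-cong e N (splice-< N (name e i) (pair e))

mainTheorem4 : Σ[ X ∈ RepresentedSpace (lsuc 0ℓ) 0ℓ ]
    ComputablyDiscrete X ×
    ComputablyHausdorff X ×
    PrecomputablyQuasiPolish X ×
    ¬ ComputableInjection X naturals
mainTheorem4 =
  X , X-discrete , X-Hausdorff , X-quasiPolish , no-computableInjection
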